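{- Let $\mathsf{IL}_{\rm b} := \mathsf{ILL}+\mathsf{PRO}$ and let $A\mapsto A^{\dagger}$ be the translation of formulas of first-order intuitionistic logic $\mathsf{IL}$ into formulas of $\mathsf{ILL}$ defined in the context. Then for every formula $A$ of $\mathsf{IL}$: $\vdash_{\mathsf{IL}} A$ if and only if $\vdash_{\mathsf{IL}_{\rm b}} A^{\dagger}$.
   Context: Intuitionistic linear logic $\mathsf{ILL}$ (first order). Formulas are built from atomic formulas, including the constants $1,\top,0$, using $\otimes,\&,\oplus,\multimap$, $\forall x,\exists x$ and $!$. Sequents are $\Gamma\vdash A$ with $\Gamma$ a finite multiset of formulas and exactly one formula on the right. Axioms: $A\vdash A$; $\vdash 1$; $\Gamma\vdash\top$; $\Gamma,0\vdash C$. Rules (premises $\Rightarrow$ conclusion): (cut) $\Gamma\vdash A;\ \Delta,A\vdash C\Rightarrow\Gamma,\Delta\vdash C$; $\Gamma\vdash C\Rightarrow\Gamma,1\vdash C$; $\Gamma\vdash A;\ \Delta\vdash B\Rightarrow\Gamma,\Delta\vdash A\otimes B$; $\Gamma,A,B\vdash C\Rightarrow\Gamma,A\otimes B\vdash C$; $\Gamma,A\vdash B\Rightarrow\Gamma\vdash A\multimap B$; $\Gamma\vdash A;\ \Delta,B\vdash C\Rightarrow\Gamma,\Delta,A\multimap B\vdash C$; $\Gamma\vdash A;\ \Gamma\vdash B\Rightarrow\Gamma\vdash A\& B$; $\Gamma,A\vdash C\Rightarrow\Gamma,A\& B\vdash C$; $\Gamma,B\vdash C\Rightarrow\Gamma,A\&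 B\vdash C$; $\Gamma\vdash A\Rightarrow\Gamma\vdash A\oplus B$; $\Gamma\vdash B\Rightarrow\Gamma\vdash A\oplus B$; $\Gamma,A\vdash C;\ \Gamma,B\vdash C\Rightarrow\Gamma,A\oplus B\vdash C$; $\Gamma\vdash A\Rightarrow\Gamma\vdash\forall xA$; $\Gamma,A[t/x]\vdash C\Rightarrow\Gamma,\forall xA\vdash C$; $\Gamma\vdash A[t/x]\Rightarrow\Gamma\vdash\exists xA$; $\Gamma,A\vdash C\Rightarrow\Gamma,\exists xA\vdash C$ (usual eigenvariable conditions); $\Gamma,!A,!A\vdash C\Rightarrow\Gamma,!A\vdash C$; $\Gamma\vdash C\Rightarrow\Gamma,!A\vdash C$; $!\Gamma\vdash A\Rightarrow\,!\Gamma\vdash\,!A$; $\Gamma,A\vdash C\Rightarrow\Gamma,!A\vdash C$. $\mathsf{PRO}$ is the axiom schema $A\vdash\,!A$ (for all formulas $A$), and $\mathsf{ILL}+\mathsf{PRO}$ is $\mathsf{ILL}$ with these additional axioms. $\vdash_S A$ means that the sequent $\vdash A$ is derivable in $S$. $\mathsf{IL}$ is standard first-order intuitionistic logic with $\wedge,\vee,\to,\bot,\forall,\exists$. The translation $(\cdot)^\dagger$: $P^\dagger:=P$ for $P$ atomic other than $\bot$; $\bot^\dagger:=0$; $(A\wedge B)^\dagger:=A^\dagger\& B^\dagger$; $(A\vee B)^\dagger:=A^\dagger\oplus B^\dagger$; $(A\to B)^\dagger:=A^\dagger\multimap B^\dagger$; $(\forall xA)^\dagger:=\forall xA^\dagger$;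 $(\exists xA)^\dagger:=\exists xA^\dagger$. -}

module Defs where

open import Data.List using (List; []; _∷_; [_]; _++_; map)
open import Data.List.Membership.Propositional using (_∈_)
open import Data.List.Relation.Binary.Permutation.Propositional using (_↭_)
open import Data.Nat using (ℕ; zero; suc)
open import Data.Vec using (Vec; []; _∷_)
open import Function using (_∘_)

record Signature : Set₁ where
  field
    Fun       : Set
    funArity  : Fun → ℕ
    Pred      : Set
    predArity : Pred → ℕ

open Signature

private
  variable
    L : Signature

-- De Bruijn indices, without a bound on the free variables: variables are
-- always available as terms, even when the signature has no constants, so
-- (∀x P) → (∃x P) is provable as usual.
data Term (L : Signature) : Set where
  var : ℕ → Term L
  fun : (f : Fun L) → Vec (Term L) (funArity L f) → Term L

Subst : Signature → Set
Subst L = ℕ → Term L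

mutual
  subT : Subst L → Term L → Term L
  subT σ (var x)    = σ x
  subT σ (fun f ts) = fun f (subTs σ ts)

  subTs : ∀ {k} → Subst L → Vec (Term L) k → Vec (Term L) k
  subTs σ []       = []
  subTs σ (t ∷ ts) = subT σ t ∷ subTs σ ts

weaken : Subst L
weaken = var ∘ suc

lift : Subst L → Subst L
lift σ zero    = var zero
lift σ (suc x) = subT weaken (σ x)

instantiate : Term L → Subst L
instantiate t zero    = t
instantiate t (suc x) = var x

module IL where

  infixr 8 _∧_
  infixr 7 _∨_
  infixr 6 _⇒_
  infix  3 _⊢_

  data Formula (L : Signature) : Set where
    atom        : (P : Pred L) → Vec (Term L) (predArity L P) → Formula L
    ⊥           : Formula L
    _∧_ _∨_ _⇒_ : Formula L → Formula L → Formula L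
    all ex      : Formula L → Formula L

  sub : Subst L → Formula L → Formula L
  sub σ (atom P ts) = atom P (subTs σ ts)
  sub σ ⊥           = ⊥
  sub σ (A ∧ B)     = sub σ A ∧ sub σ B
  sub σ (A ∨ B)     = sub σ A ∨ sub σ B
  sub σ (A ⇒ B)     = sub σ A ⇒ sub σ B
  sub σ (all A)     = all (sub (lift σ) A)
  sub σ (ex A)      = ex (sub (lift σ) A)

  -- Moves a formula under one more binder; weakening the context in ∀I and
  -- ∃E is the eigenvariable condition: index 0 does not occur in it.
  shift : Formula L → Formula L
  shift = sub weaken

  _⟨_⟩ : Formula L → Term L → Formula L
  A ⟨ t ⟩ = sub (instantiate t) A

  private
    variable
      A B C : Formula L
      Γ     : List (Formula L)

  -- Natural deduction NJ.
  data _⊢_ {L : Signature} : List (Formula L) → Formula L → Set where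
    ax  : A ∈ Γ → Γ ⊢ A
    ⊥E  : Γ ⊢ ⊥ → Γ ⊢ C
    ∧I  : Γ ⊢ A → Γ ⊢ B → Γ ⊢ A ∧ B
    ∧E₁ : Γ ⊢ A ∧ B → Γ ⊢ A
    ∧E₂ : Γ ⊢ A ∧ B → Γ ⊢ B
    ∨I₁ : Γ ⊢ A → Γ ⊢ A ∨ B
    ∨I₂ : Γ ⊢ B → Γ ⊢ A ∨ B
    ∨E  : Γ ⊢ A ∨ B → A ∷ Γ ⊢ C → B ∷ Γ ⊢ C → Γ ⊢ C
    ⇒I  : A ∷ Γ ⊢ B → Γ ⊢ A ⇒ B
    ⇒E  : Γ ⊢ A ⇒ B → Γ ⊢ A → Γ ⊢ B
    ∀I  : map shift Γ ⊢ A → Γ ⊢ all A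
    ∀E  : Γ ⊢ all A → (t : Term L) → Γ ⊢ A ⟨ t ⟩
    ∃I  : (t : Term L) → Γ ⊢ A ⟨ t ⟩ → Γ ⊢ ex A
    ∃E  : Γ ⊢ ex A → A ∷ map shift Γ ⊢ shift C → Γ ⊢ C

module ILL where

  infix  9 !_
  infixr 8 _⊗_ _&_
  infixr 7 _⊕_
  infixr 6 _⊸_
  infix  3 _∣_⊢_

  data Formula (L : Signature) : Set where
    atom            : (P : Pred L) → Vec (Term L) (predArity L P) → Formula L
    𝟏 ⊤ 𝟎           : Formula L
    _⊗_ _&_ _⊕_ _⊸_ : Formula L → Formula L → Formula L
    all ex          : Formula L → Formula L
    !_              : Formula L → Formula L

  sub : Subst L → Formula L → Formula L
  sub σ (atom P ts) = atom P (subTs σ ts)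
  sub σ 𝟏           = 𝟏
  sub σ ⊤           = ⊤
  sub σ 𝟎           = 𝟎
  sub σ (A ⊗ B)     = sub σ A ⊗ sub σ B
  sub σ (A & B)     = sub σ A & sub σ B
  sub σ (A ⊕ B)     = sub σ A ⊕ sub σ B
  sub σ (A ⊸ B)     = sub σ A ⊸ sub σ B
  sub σ (all A)     = all (sub (lift σ) A)
  sub σ (ex A)      = ex (sub (lift σ) A)
  sub σ (! A)       = ! sub σ A

  shift : Formula L → Formula L
  shift = sub weaken

  _⟨_⟩ : Formula L → Term L → Formula L
  A ⟨ t ⟩ = sub (instantiate t) A

  Axioms : Signature → Set₁
  Axioms L = List (Formula L) → Formula L → Set

  private
    variable
      A B C : Formula L
      Γ Δ   : List (Formula L)

  -- Ax ∣ Γ ⊢ A is derivability in ILL extended by the axioms Ax. Multisets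
  -- are lists with the exchange rule exch; the principal formula on the
  -- left is put first.
  data _∣_⊢_ {L : Signature} (Ax : Axioms L) :
             List (Formula L) → Formula L → Set where
    axiom : Ax Γ A → Ax ∣ Γ ⊢ A
    exch  : Γ ↭ Δ → Ax ∣ Γ ⊢ C → Ax ∣ Δ ⊢ C
    id    : Ax ∣ [ A ] ⊢ A
    cut   : Ax ∣ Γ ⊢ A → Ax ∣ A ∷ Δ ⊢ C → Ax ∣ Γ ++ Δ ⊢ C
    𝟏R    : Ax ∣ [] ⊢ 𝟏
    𝟏L    : Ax ∣ Γ ⊢ C → Ax ∣ 𝟏 ∷ Γ ⊢ C
    ⊤R    : Ax ∣ Γ ⊢ ⊤
    𝟎L    : Ax ∣ 𝟎 ∷ Γ ⊢ C
    ⊗R    : Ax ∣ Γ ⊢ A → Ax ∣ Δ ⊢ B → Ax ∣ Γ ++ Δ ⊢ A ⊗ B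
    ⊗L    : Ax ∣ A ∷ B ∷ Γ ⊢ C → Ax ∣ A ⊗ B ∷ Γ ⊢ C
    ⊸R    : Ax ∣ A ∷ Γ ⊢ B → Ax ∣ Γ ⊢ A ⊸ B
    ⊸L    : Ax ∣ Γ ⊢ A → Ax ∣ B ∷ Δ ⊢ C → Ax ∣ A ⊸ B ∷ Γ ++ Δ ⊢ C
    &R    : Ax ∣ Γ ⊢ A → Ax ∣ Γ ⊢ B → Ax ∣ Γ ⊢ A & B
    &L₁   : Ax ∣ A ∷ Γ ⊢ C → Ax ∣ A & B ∷ Γ ⊢ C
    &L₂   : Ax ∣ B ∷ Γ ⊢ C → Ax ∣ A & B ∷ Γ ⊢ C
    ⊕R₁   : Ax ∣ Γ ⊢ A → Ax ∣ Γ ⊢ A ⊕ B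
    ⊕R₂   : Ax ∣ Γ ⊢ B → Ax ∣ Γ ⊢ A ⊕ B
    ⊕L    : Ax ∣ A ∷ Γ ⊢ C → Ax ∣ B ∷ Γ ⊢ C → Ax ∣ A ⊕ B ∷ Γ ⊢ C
    ∀R    : Ax ∣ map shift Γ ⊢ A → Ax ∣ Γ ⊢ all A
    ∀L    : (t : Term L) → Ax ∣ A ⟨ t ⟩ ∷ Γ ⊢ C → Ax ∣ all A ∷ Γ ⊢ C
    ∃R    : (t : Term L) → Ax ∣ Γ ⊢ A ⟨ t ⟩ → Ax ∣ Γ ⊢ ex A
    ∃L    : Ax ∣ A ∷ map shift Γ ⊢ shift C → Ax ∣ ex A ∷ Γ ⊢ C
    !C    : Ax ∣ ! A ∷ ! A ∷ Γ ⊢ C → Ax ∣ ! A ∷ Γ ⊢ C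
    !W    : Ax ∣ Γ ⊢ C → Ax ∣ ! A ∷ Γ ⊢ C
    !R    : Ax ∣ map !_ Γ ⊢ A → Ax ∣ map !_ Γ ⊢ ! A
    !L    : Ax ∣ A ∷ Γ ⊢ C → Ax ∣ ! A ∷ Γ ⊢ C

  data PRO {L : Signature} : Axioms L where
    pro : (A : Formula L) → PRO [ A ] (! A)

infix 10 _†

_† : IL.Formula L → ILL.Formula L
IL.atom P ts † = ILL.atom P ts
IL.⊥         † = ILL.𝟎
(A IL.∧ B)   † = A † ILL.& B †
(A IL.∨ B)   † = A † ILL.⊕ B †
(A IL.⇒ B)   † = A † ILL.⊸ B †
IL.all A     † = ILL.all (A †)
IL.ex A      † = ILL.ex (A †)

infix 3 ⊢IL_ ⊢ILb_

⊢IL_ : IL.Formula L → Set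
⊢IL A = [] IL.⊢ A

⊢ILb_ : ILL.Formula L → Set
⊢ILb A = ILL.PRO ILL.∣ [] ⊢ A

{-# OPTIONS --safe #-}

-- With A ⊢ !A, contraction and weakening become admissible for arbitrary
-- formulas, so the additive cut is available and natural deduction can be
-- simulated.
-- Conversely, erasing ! and reading both ⊗ and & as ∧ turns every rule of
-- ILL + PRO into an admissible rule of IL, and this erasure inverts †.
module Submission where

open import Data.List using (List; []; _∷_; _++_; map)
open import Data.List.Membership.Propositional using (_∈_)
open import Data.List.Membership.Propositional.Properties using (∈-map⁺)
open import Data.List.Properties using (++-identityʳ; map-++; map-∘; map-cong)
open import Data.List.Relation.Binary.Permutation.Propositional
  using (prep; ↭-sym; ↭-trans)
open import Data.List.Relation.Binary.Permutation.Propositional.Properties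
  using (∈-resp-↭; map⁺; ++⁺ˡ) renaming (shift to ↭-shift)
open import Data.List.Relation.Binary.Subset.Propositional using (_⊆_)
open import Data.List.Relation.Binary.Subset.Propositional.Properties
  using (∷⁺ʳ; xs⊆x∷xs; xs⊆xs++ys; xs⊆ys++xs)
  renaming (map⁺ to ⊆-map⁺)
open import Data.List.Relation.Unary.Any using (here; there)
open import Function using (_∘_)
open import Function.Bundles using (_⇔_; mk⇔)
open import Relation.Binary.PropositionalEquality
  using (_≡_; refl; sym; trans; cong; cong₂; subst; subst₂)
open import Defs
open IL using (_⊢_; ax; ⊥E; ∧I; ∧E₁; ∧E₂; ∨I₁; ∨I₂; ∨E; ⇒I; ⇒E; ∀I; ∀E; ∃I; ∃E)
open ILL

private
  variable
    L : Signature

sub-† : (σ : Subst L) (A : IL.Formula L) → IL.sub σ A † ≡ sub σ (A †)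
sub-† σ (IL.atom P ts) = refl
sub-† σ IL.⊥           = refl
sub-† σ (A IL.∧ B)     = cong₂ _&_ (sub-† σ A) (sub-† σ B)
sub-† σ (A IL.∨ B)     = cong₂ _⊕_ (sub-† σ A) (sub-† σ B)
sub-† σ (A IL.⇒ B)     = cong₂ _⊸_ (sub-† σ A) (sub-† σ B)
sub-† σ (IL.all A)     = cong all (sub-† (lift σ) A)
sub-† σ (IL.ex A)      = cong ex (sub-† (lift σ) A)

-- Identifies the shifted contexts in the premises of `∀I` and `∃E` with those that `∀R` and `∃L`
-- expect.
map-shift-† : (Γ : List (IL.Formula L)) →
              map _† (map IL.shift Γ) ≡ map ILL.shift (map _† Γ)
map-shift-† Γ =
  trans (sym (map-∘ Γ)) (trans (map-cong (sub-† weaken) Γ) (map-∘ Γ))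

module _ {L : Signature} where

  private
    variable
      A B C : Formula L
      Γ Δ   : List (Formula L)

  weakening : PRO ∣ Γ ⊢ C → PRO ∣ A ∷ Γ ⊢ C
  weakening d = cut (axiom (pro _)) (!W d)

  contraction : PRO ∣ A ∷ A ∷ Γ ⊢ C → PRO ∣ A ∷ Γ ⊢ C
  contraction {A = A} {Γ = Γ} d =
    -- Read upwards from `d`: dereliction turns one copy of `A` into `! A`, the exchange brings the
    -- other copy to the front for a second dereliction, `!C` merges the two, and the cut with
    -- `A ⊢ ! A` restores `A`.
    cut (axiom (pro A))
        (!C (!L (exch (↭-shift A (! A ∷ []) Γ) (!L d))))

  -- Induction on `Γ`: the two copies of the head are brought together and contracted, and the
  -- surviving copy is moved into the frame `Δ`, which must therefore stay general.
  contraction-++ : ∀ Γ → PRO ∣ Γ ++ Γ ++ Δ ⊢ C → PRO ∣ Γ ++ Δ ⊢ C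
  contraction-++         []      d = d
  contraction-++ {Δ = Δ} (A ∷ Γ) d =
    exch (↭-shift A Γ Δ)
      (contraction-++ Γ
        (exch (↭-sym (↭-trans (++⁺ˡ Γ (↭-shift A Γ Δ)) (↭-shift A Γ (Γ ++ Δ))))
          (contraction (exch (prep A (↭-shift A Γ (Γ ++ Δ))) d))))

  head : ∀ Γ → PRO ∣ A ∷ Γ ⊢ A
  head         []      = id
  head {A = A} (B ∷ Γ) = exch (↭-shift A (B ∷ []) Γ) (weakening (head Γ))

  member : A ∈ Γ → PRO ∣ Γ ⊢ A
  member (here refl) = head _
  member (there i)   = weakening (member i)

  -- The multiplicative cut produces `Γ ++ Γ`, which `contraction-++` with an empty frame reduces to
  -- `Γ`.
  additive-cut : PRO ∣ Γ ⊢ A → PRO ∣ A ∷ Γ ⊢ C → PRO ∣ Γ ⊢ C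
  additive-cut {Γ = Γ} {C = C} d e =
    subst (PRO ∣_⊢ C) (++-identityʳ Γ)
      (contraction-++ Γ
        (subst (λ Δ → PRO ∣ Γ ++ Δ ⊢ C) (sym (++-identityʳ Γ)) (cut d e)))

  modus-ponens : PRO ∣ Γ ⊢ A ⊸ B → PRO ∣ Γ ⊢ A → PRO ∣ Γ ⊢ B
  modus-ponens {Γ = Γ} {A = A} {B = B} d e =
    additive-cut d
      (subst (λ Δ → PRO ∣ A ⊸ B ∷ Δ ⊢ B) (++-identityʳ Γ) (⊸L e id))

-- Introductions become right rules. An elimination becomes the left rule of the same connective,
-- joined by `additive-cut` to the translated major premise.
IL⇒ILb : {Γ : List (IL.Formula L)} {A : IL.Formula L} →
         Γ ⊢ A → PRO ∣ map _† Γ ⊢ A †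
IL⇒ILb (ax i)      = member (∈-map⁺ _† i)
IL⇒ILb (⊥E d)      = additive-cut (IL⇒ILb d) 𝟎L
IL⇒ILb (∧I d e)    = &R (IL⇒ILb d) (IL⇒ILb e)
IL⇒ILb (∧E₁ d)     = additive-cut (IL⇒ILb d) (&L₁ (head _))
IL⇒ILb (∧E₂ d)     = additive-cut (IL⇒ILb d) (&L₂ (head _))
IL⇒ILb (∨I₁ d)     = ⊕R₁ (IL⇒ILb d)
IL⇒ILb (∨I₂ d)     = ⊕R₂ (IL⇒ILb d)
IL⇒ILb (∨E d e f)  = additive-cut (IL⇒ILb d) (⊕L (IL⇒ILb e) (IL⇒ILb f))
IL⇒ILb (⇒I d)      = ⊸R (IL⇒ILb d)
IL⇒ILb (⇒E d e)    = modus-ponens (IL⇒ILb d) (IL⇒ILb e)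
IL⇒ILb {Γ = Γ} {IL.all A} (∀I d) =
  ∀R (subst (PRO ∣_⊢ A †) (map-shift-† Γ) (IL⇒ILb d))
IL⇒ILb (∀E {A = A} d t) =
  additive-cut (IL⇒ILb d)
    (∀L t (member (here (sub-† (instantiate t) A))))
IL⇒ILb {Γ = Γ} {IL.ex A} (∃I t d) =
  ∃R t (subst (PRO ∣ map _† Γ ⊢_) (sub-† (instantiate t) A) (IL⇒ILb d))
IL⇒ILb {Γ = Γ} (∃E {A = A} {C = C} d e) =
  additive-cut (IL⇒ILb d)
    (∃L (subst₂ (λ Δ B → PRO ∣ A † ∷ Δ ⊢ B)
                (map-shift-† Γ) (sub-† weaken C) (IL⇒ILb e)))

-- IL has no constant for truth; `⊥ ⇒ ⊥` is a provable closed formula that stands in for both `𝟏`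
-- and `⊤`.
erase : Formula L → IL.Formula L
erase (atom P ts) = IL.atom P ts
erase 𝟏           = IL.⊥ IL.⇒ IL.⊥
erase ⊤           = IL.⊥ IL.⇒ IL.⊥
erase 𝟎           = IL.⊥
erase (A ⊗ B)     = erase A IL.∧ erase B
erase (A & B)     = erase A IL.∧ erase B
erase (A ⊕ B)     = erase A IL.∨ erase B
erase (A ⊸ B)     = erase A IL.⇒ erase B
erase (all A)     = IL.all (erase A)
erase (ex A)      = IL.ex (erase A)
erase (! A)       = erase A

erase-sub : (σ : Subst L) (A : Formula L) →
            erase (sub σ A) ≡ IL.sub σ (erase A)
erase-sub σ (atom P ts) = refl
erase-sub σ 𝟏           = refl
erase-sub σ ⊤           = refl
erase-sub σ 𝟎           = refl
erase-sub σ (A ⊗ B)     = cong₂ IL._∧_ (erase-sub σ A) (erase-sub σ B)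
erase-sub σ (A & B)     = cong₂ IL._∧_ (erase-sub σ A) (erase-sub σ B)
erase-sub σ (A ⊕ B)     = cong₂ IL._∨_ (erase-sub σ A) (erase-sub σ B)
erase-sub σ (A ⊸ B)     = cong₂ IL._⇒_ (erase-sub σ A) (erase-sub σ B)
erase-sub σ (all A)     = cong IL.all (erase-sub (lift σ) A)
erase-sub σ (ex A)      = cong IL.ex (erase-sub (lift σ) A)
erase-sub σ (! A)       = erase-sub σ A

erase-† : (A : IL.Formula L) → erase (A †) ≡ A
erase-† (IL.atom P ts) = refl
erase-† IL.⊥           = refl
erase-† (A IL.∧ B)     = cong₂ IL._∧_ (erase-† A) (erase-† B)
erase-† (A IL.∨ B)     = cong₂ IL._∨_ (erase-† A) (erase-† B)
erase-† (A IL.⇒ B)     = cong₂ IL._⇒_ (erase-† A) (erase-† B)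
erase-† (IL.all A)     = cong IL.all (erase-† A)
erase-† (IL.ex A)      = cong IL.ex (erase-† A)

map-erase-shift : (Γ : List (Formula L)) →
                  map erase (map ILL.shift Γ) ≡ map IL.shift (map erase Γ)
map-erase-shift Γ =
  trans (sym (map-∘ Γ)) (trans (map-cong (erase-sub weaken) Γ) (map-∘ Γ))

module _ {L : Signature} where

  private
    variable
      A B C : IL.Formula L
      Γ Δ   : List (IL.Formula L)

  -- Inclusion compares membership only, so this covers weakening, exchange and contraction at once.
  monotone : Γ ⊆ Δ → Γ ⊢ A → Δ ⊢ A
  monotone s (ax i)     = ax (s i)
  monotone s (⊥E d)     = ⊥E (monotone s d)
  monotone s (∧I d e)   = ∧I (monotone s d) (monotone s e)
  monotone s (∧E₁ d)    = ∧E₁ (monotone s d)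
  monotone s (∧E₂ d)    = ∧E₂ (monotone s d)
  monotone s (∨I₁ d)    = ∨I₁ (monotone s d)
  monotone s (∨I₂ d)    = ∨I₂ (monotone s d)
  monotone s (∨E d e f) =
    ∨E (monotone s d) (monotone (∷⁺ʳ _ s) e) (monotone (∷⁺ʳ _ s) f)
  monotone s (⇒I d)     = ⇒I (monotone (∷⁺ʳ _ s) d)
  monotone s (⇒E d e)   = ⇒E (monotone s d) (monotone s e)
  monotone s (∀I d)     = ∀I (monotone (⊆-map⁺ IL.shift s) d)
  monotone s (∀E d t)   = ∀E (monotone s d) t
  monotone s (∃I t d)   = ∃I t (monotone s d)
  monotone s (∃E d e)   =
    ∃E (monotone s d) (monotone (∷⁺ʳ _ (⊆-map⁺ IL.shift s)) e)

  wk : Γ ⊢ A → B ∷ Γ ⊢ A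
  wk = monotone (xs⊆x∷xs _ _)

  hyp : A ∷ Γ ⊢ A
  hyp = ax (here refl)

  IL-cut : Γ ⊢ A → A ∷ Γ ⊢ C → Γ ⊢ C
  IL-cut d e = ⇒E (⇒I e) d

  -- Pattern of a left rule: the principal formula `B` yields its component `A` and remains
  -- available as a hypothesis.
  replace : B ∷ Γ ⊢ A → A ∷ Γ ⊢ C → B ∷ Γ ⊢ C
  replace d e = IL-cut d (monotone (∷⁺ʳ _ (xs⊆x∷xs _ _)) e)

ILb⇒IL : {Γ : List (Formula L)} {A : Formula L} →
         PRO ∣ Γ ⊢ A → map erase Γ ⊢ erase A
-- `A` and `! A` have the same erasure, so the axiom becomes an identity.
ILb⇒IL (axiom (pro A)) = hyp
ILb⇒IL (exch p d)      = monotone (∈-resp-↭ (map⁺ erase p)) (ILb⇒IL d)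
ILb⇒IL id              = hyp
-- Both parts of a split context embed in their concatenation, which turns the multiplicative rule
-- into an additive one.
ILb⇒IL (cut {Γ = Γ} {Δ = Δ} d e)
  rewrite map-++ erase Γ Δ =
  IL-cut (monotone (xs⊆xs++ys _ _) (ILb⇒IL d))
         (monotone (∷⁺ʳ _ (xs⊆ys++xs _ (map erase Γ))) (ILb⇒IL e))
ILb⇒IL 𝟏R              = ⇒I hyp
ILb⇒IL (𝟏L d)          = wk (ILb⇒IL d)
ILb⇒IL ⊤R              = ⇒I hyp
ILb⇒IL 𝟎L              = ⊥E hyp
ILb⇒IL (⊗R {Γ = Γ} {Δ = Δ} d e)
  rewrite map-++ erase Γ Δ =
  ∧I (monotone (xs⊆xs++ys _ _) (ILb⇒IL d))
     (monotone (xs⊆ys++xs _ (map erase Γ)) (ILb⇒IL e))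
-- The second component is cut in first, so that the first one ends up in front, as in the premise.
ILb⇒IL (⊗L d)          =
  IL-cut (∧E₂ hyp)
    (IL-cut (∧E₁ (wk hyp))
      (monotone (∷⁺ʳ _ (∷⁺ʳ _ (xs⊆x∷xs _ _))) (ILb⇒IL d)))
ILb⇒IL (⊸R d)          = ⇒I (ILb⇒IL d)
ILb⇒IL (⊸L {Γ = Γ} {Δ = Δ} d e)
  rewrite map-++ erase Γ Δ =
  replace (⇒E hyp (wk (monotone (xs⊆xs++ys _ _) (ILb⇒IL d))))
          (monotone (∷⁺ʳ _ (xs⊆ys++xs _ (map erase Γ))) (ILb⇒IL e))
ILb⇒IL (&R d e)        = ∧I (ILb⇒IL d) (ILb⇒IL e)
ILb⇒IL (&L₁ d)         = replace (∧E₁ hyp) (ILb⇒IL d)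
ILb⇒IL (&L₂ d)         = replace (∧E₂ hyp) (ILb⇒IL d)
ILb⇒IL (⊕R₁ d)         = ∨I₁ (ILb⇒IL d)
ILb⇒IL (⊕R₂ d)         = ∨I₂ (ILb⇒IL d)
ILb⇒IL (⊕L d e)        =
  ∨E hyp (monotone (∷⁺ʳ _ (xs⊆x∷xs _ _)) (ILb⇒IL d))
         (monotone (∷⁺ʳ _ (xs⊆x∷xs _ _)) (ILb⇒IL e))
ILb⇒IL {Γ = Γ} {all A} (∀R d) =
  ∀I (subst (_⊢ erase A) (map-erase-shift Γ) (ILb⇒IL d))
ILb⇒IL (∀L {A = A} t d) =
  replace (subst (_ ⊢_) (sym (erase-sub (instantiate t) A)) (∀E hyp t)) (ILb⇒IL d)
ILb⇒IL {A = ex A} (∃R t d) =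
  ∃I t (subst (_ ⊢_) (erase-sub (instantiate t) A) (ILb⇒IL d))
ILb⇒IL {A = C} (∃L {A = A} {Γ = Γ} d) =
  ∃E hyp (monotone (∷⁺ʳ _ (xs⊆x∷xs _ _))
    (subst₂ (λ Δ B → erase A ∷ Δ ⊢ B)
            (map-erase-shift Γ) (erase-sub weaken C) (ILb⇒IL d)))
-- Contraction is a cut of the duplicated formula against the remaining hypothesis.
ILb⇒IL (!C d)          = IL-cut hyp (ILb⇒IL d)
ILb⇒IL (!W d)          = wk (ILb⇒IL d)
ILb⇒IL (!R d)          = ILb⇒IL d
ILb⇒IL (!L d)          = ILb⇒IL d

proposition1 : (L : Signature) (A : IL.Formula L) → (⊢IL A) ⇔ (⊢ILb (A †))
proposition1 L A = mk⇔ IL⇒ILb (subst ([] ⊢_) (erase-† A) ∘ ILb⇒IL)
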